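{- The propositional modal logics $S4$, $S4.3$ and $S5$ are sound and complete for the classes of arbitrary orbital Kripke frames, linear-time orbital Kripke frames, and invertible orbital Kripke frames, respectively. That is, for every modal formula $A$: (1) $A$ is a theorem of $S4$ if and only if $A$ is valid in all orbital Kripke frames; (2) $A$ is a theorem of $S4.3$ if and only if $A$ is valid in all linear-time orbital Kripke frames; (3) $A$ is a theorem of $S5$ if and only if $A$ is valid in all invertible orbital Kripke frames.
   Context: Monoids. For a monoid $\mathbb M=(M,0,+)$ (written additively, not assumed commutative) and $a,b\in M$, write $a\leq_{\mathbb M} b$ iff there is $c\in M$ with $a+c=b$. The monoid $\mathbb M$ is called linear iff for all $a,b\in M$, $a\leq_{\mathbb M}b$ or $b\leq_{\mathbb M}a$; it is called symmetric iff $\leq_{\mathbb M}$ is a symmetric relation. Dynamical systems. A dynamical system $\mathbb S=(\mathbb T,S,\Phi)$ consists of a monoid $\mathbb T=(T,0,+)$ (time), a set $S$ (state space) and a map $\Phi:S\times T\to S$ with $\Phi(s,0)=s$ and $\Phi(\Phi(s,t),u)=\Phi(s,t+u)$ for all $s\in S$, $t,u\in T$. It is linear-time iff $\mathbb T$ is linear, and invertible iff $\mathbb T$ is symmetric. The orbit of $s\in S$ is $\Phi^\circ(s)=\{\Phi(s,t)\mid t\in T\}$. The reachability relation is $x\leadsto_{\mathbb S}y$ iff $y\in\Phi^\circ(x)$. Frames. A Kripke frame is a pair $(W,R)$ of a set $W$ and a binary relation $R$ on $W$. It is called orbital iff there is a dynamical system $\mathbb S=(\mathbb T,S,\Phi)$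 with $S=W$ and $(\leadsto_{\mathbb S})=R$. An orbital frame is called linear-time (resp. invertible) iff such an $\mathbb S$ can be found that is linear-time (resp. invertible). Formulas and validity. Modal formulas are built from a fixed set of atomic propositions with $\neg$, $\to$, $\Box$; other Boolean connectives are defined classically and $\lozenge A=\neg\Box\neg A$. A Kripke model on $(W,R)$ is a satisfaction relation $\Vdash$ between $W$ and formulas such that $w\Vdash\neg A$ iff $w\not\Vdash A$; $w\Vdash A\to B$ iff $w\not\Vdash A$ or $w\Vdash B$; $w\Vdash\Box A$ iff $v\Vdash A$ for all $v$ with $w\mathrel R v$ (satisfaction of atomic propositions being arbitrary). A formula is valid in a frame $(W,R)$ iff it is satisfied at every world of every Kripke model on $(W,R)$. Logics. A normal modal logic contains classical propositional logic (with modus ponens), the necessitation rule $A\vdash\Box A$, and all instances of $\Box(A\to B)\to(\Box A\to\Box B)$. $S4$ is the normal modal logic obtained by adding the axiom schemes $\Box A\to A$ and $\Box A\to\Box\Box A$ to the minimal one. $S4.3$ is $S4$ plus the axiom scheme $\Box(\Box A\to B)\lor\Box(\Box B\to A)$. $S5$ is $S4$ plus the axiom scheme $\lozenge A\to\Box\lozenge A$. -}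

module Defs where

open import Algebra.Structures using (IsMonoid)
open import Data.Product using (Σ-syntax; ∃-syntax; _×_)
open import Data.Sum using (_⊎_)
open import Function.Bundles using (_⇔_)
open import Relation.Binary.Core using (Rel)
open import Relation.Binary.Definitions using (Symmetric; Total)
open import Relation.Binary.PropositionalEquality using (_≡_)
open import Relation.Nullary using (¬_)
open import Relation.Unary using (Pred; _∈_)
open import Level using (0ℓ)

infix  30 ∼_ □_ ◇_
infixr 20 _⊃_
infixr 25 _∨_
infix  10 _⊢_ _⊨_

record DynamicalSystem (S : Set) : Set₁ where
  infixl 6 _+_
  infix  4 _≤_ _⇝_
  field
    T        : Set
    _+_      : T → T → T
    0#       : T
    isMonoid : IsMonoid _≡_ _+_ 0#
    Φ        : S → T → S
    Φ-0      : ∀ s → Φ s 0# ≡ s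
    Φ-+      : ∀ s t u → Φ (Φ s t) u ≡ Φ s (t + u)

  _≤_ : Rel T 0ℓ
  a ≤ b = ∃[ c ] a + c ≡ b

  LinearTime : Set
  LinearTime = Total _≤_

  Invertible : Set
  Invertible = Symmetric _≤_

  orbit : S → Pred S 0ℓ
  orbit s y = ∃[ t ] Φ s t ≡ y

  _⇝_ : Rel S 0ℓ
  x ⇝ y = y ∈ orbit x

record Frame : Set₁ where
  field
    W : Set
    R : Rel W 0ℓ

-- Equality of the relations (⇝) and R is extensional: they relate the same
-- pairs of worlds.
Realises : (F : Frame) → DynamicalSystem (Frame.W F) → Set
Realises F 𝕊 = ∀ x y → x ⇝ y ⇔ R x y
  where
  open Frame F
  open DynamicalSystem 𝕊

Orbital : Pred Frame _
Orbital F = Σ[ 𝕊 ∈ DynamicalSystem (Frame.W F) ] Realises F 𝕊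

LinearTimeOrbital : Pred Frame _
LinearTimeOrbital F =
  Σ[ 𝕊 ∈ DynamicalSystem (Frame.W F) ] DynamicalSystem.LinearTime 𝕊 × Realises F 𝕊

InvertibleOrbital : Pred Frame _
InvertibleOrbital F =
  Σ[ 𝕊 ∈ DynamicalSystem (Frame.W F) ] DynamicalSystem.Invertible 𝕊 × Realises F 𝕊

data Formula (Atom : Set) : Set where
  atom : Atom → Formula Atom
  ∼_   : Formula Atom → Formula Atom
  _⊃_  : Formula Atom → Formula Atom → Formula Atom
  □_   : Formula Atom → Formula Atom

_∨_ : {Atom : Set} → Formula Atom → Formula Atom → Formula Atom
A ∨ B = ∼ A ⊃ B

◇_ : {Atom : Set} → Formula Atom → Formula Atom
◇ A = ∼ □ ∼ A

-- Satisfaction of atoms is left unconstrained.  The clause for ⊃ is the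
-- classical disjunction, so A ⊃ A holds at w only if w ⊩ A is decided;
-- results about validity need excluded middle for that reason.
record Model (Atom : Set) (F : Frame) : Set₁ where
  open Frame F
  infix 10 _⊩_
  field
    _⊩_ : W → Formula Atom → Set
    ⊩-∼ : ∀ w A   → (w ⊩ ∼ A) ⇔ (¬ (w ⊩ A))
    ⊩-⊃ : ∀ w A B → (w ⊩ A ⊃ B) ⇔ (¬ (w ⊩ A) ⊎ (w ⊩ B))
    ⊩-□ : ∀ w A   → (w ⊩ □ A) ⇔ (∀ v → R w v → v ⊩ A)

_⊨_ : {Atom : Set} → Frame → Formula Atom → Set₁
F ⊨ A = (M : Model _ F) → ∀ w → Model._⊩_ M w A

-- The least normal modal logic containing the given axioms.  Classical
-- propositional logic is given by Łukasiewicz's axiom schemes for ∼ and ⊃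
-- together with modus ponens.
data _⊢_ {Atom : Set} (Ax : Pred (Formula Atom) 0ℓ) : Pred (Formula Atom) 0ℓ where
  ax     : ∀ {A} → A ∈ Ax → Ax ⊢ A
  weak   : ∀ A B → Ax ⊢ A ⊃ (B ⊃ A)
  distr  : ∀ A B C → Ax ⊢ (A ⊃ (B ⊃ C)) ⊃ ((A ⊃ B) ⊃ (A ⊃ C))
  contra : ∀ A B → Ax ⊢ (∼ A ⊃ ∼ B) ⊃ (B ⊃ A)
  □-K    : ∀ A B → Ax ⊢ □ (A ⊃ B) ⊃ (□ A ⊃ □ B)
  mp     : ∀ {A B} → Ax ⊢ A ⊃ B → Ax ⊢ A → Ax ⊢ B
  nec    : ∀ {A} → Ax ⊢ A → Ax ⊢ □ A

data S4 {Atom : Set} : Pred (Formula Atom) 0ℓ where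
  □-T : ∀ A → S4 (□ A ⊃ A)
  □-4 : ∀ A → S4 (□ A ⊃ □ □ A)

data S4·3 {Atom : Set} : Pred (Formula Atom) 0ℓ where
  s4  : ∀ {A} → A ∈ S4 → S4·3 A
  □-3 : ∀ A B → S4·3 (□ (□ A ⊃ B) ∨ □ (□ B ⊃ A))

data S5 {Atom : Set} : Pred (Formula Atom) 0ℓ where
  s4  : ∀ {A} → A ∈ S4 → S5 A
  □-5 : ∀ A → S5 (◇ A ⊃ □ ◇ A)

{-# OPTIONS --safe #-}

-- Soundness: reachability is reflexive and transitive, it is connected on each
-- orbit when time is linear, and symmetric when time is symmetric.
--
-- Completeness: worlds are consistent theories deciding a finite list Θ of
-- formulas that contains the subformulas of A, so that Lindenbaum's lemma needs
-- no choice.  They are ordered by inclusion of the boxed formulas in Θ.  For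
-- each logic, a dynamical system is mapped to the worlds in such a way that
-- flows preserve boxes and every refuted box is refuted at a reachable state.
--   * S4: the free monoid on the inflationary maps of worlds acts on worlds, and
--     reaches from w exactly the worlds above w.
--   * S4.3: Θ also contains □ (□ P ⊃ Q) for subformulas P, Q.  Above a fixed
--     world the order is then the total order by rank, the number of boxed
--     subformulas that hold.  The monoid of ordinals below ω², acting on itself,
--     is mapped to worlds so that ω·a + b climbs through the ranks with a and,
--     within a rank, refutes each refutable subformula for cofinally many b.
--   * S5: Θ also contains □ ∼ B for subformulas B, which makes the order
--     symmetric.  The group ℤ is mapped to the cluster of a single world,
--     refuting each refutable subformula somewhere.

module Submission where

open import Defs
open import Axiom.ExcludedMiddle using (ExcludedMiddle)
open import Algebra.Structures using (IsMonoid)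
open import Data.Bool using (Bool; true; false; T)
open import Data.Empty using (⊥-elim)
open import Data.Fin using (Fin; toℕ)
open import Data.Fin.Properties using (toℕ-injective; toℕ-fromℕ<; toℕ<n)
open import Data.Integer using (ℤ; ∣_∣)
import Data.Integer as ℤ
import Data.Integer.Properties as ℤ
open import Data.List using
  (List; []; _∷_; _++_; length; filterᵇ; foldl; lookup; map; cartesianProductWith)
open import Data.List.Membership.Propositional using (_∈_)
open import Data.List.Membership.Propositional.Properties using
  (∈-++⁺ˡ; ∈-++⁺ʳ; ∈-map⁺; ∈-cartesianProductWith⁺)
open import Data.List.Properties using (++-isMonoid; foldl-++)
open import Data.List.Relation.Unary.Any using (here; there; index)
open import Data.List.Relation.Unary.Any.Properties using (lookup-index)
open import Data.Nat using (ℕ; zero; suc; _+_; _*_; _∸_; _≤_; _<_; s≤s; z≤n)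
open import Data.Nat.DivMod using (_mod_; _%_; [m+kn]%n≡m%n; m<n⇒m%n≡m)
open import Data.Nat.Properties using
  (+-assoc; +-identityʳ; +-suc; +-monoʳ-≤; ≤-refl; ≤-reflexive; ≤-trans; ≤-total; <-cmp;
   ≤-antisym; ≤-<-connex; m≤n⇒m≤1+n; n≤1+n; 1+n≰n; m+[n∸m]≡n; m≤n⇒∃[o]m+o≡n)
open import Data.Nat.Tactic.RingSolver using (solve-∀)
open import Data.Product using (_×_; _,_; ∃-syntax; Σ-syntax; proj₁; proj₂)
open import Data.Sum using (_⊎_; inj₁; inj₂; [_,_]′)
open import Function using (_∘_; id)
open import Function.Bundles using (_⇔_; mk⇔; Equivalence)
open import Level using (0ℓ)
open import Relation.Binary.Core using (Rel)
open import Relation.Binary.Definitions using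
  (Reflexive; Transitive; Symmetric; tri<; tri≈; tri>)
open import Relation.Binary.PropositionalEquality
open import Relation.Nullary using (¬_; yes; no; contradiction)
open import Relation.Nullary.Decidable using (⌊_⌋; toWitness; fromWitness)
open import Relation.Unary using (Pred; _∪_; ｛_｝; _⊆_; ∅)

open Equivalence using (to; from)

-- Reachability

module Reachability {S : Set} (𝕊 : DynamicalSystem S) where
  open DynamicalSystem 𝕊 using (_⇝_; Φ; Φ-0; Φ-+; 0#; LinearTime; Invertible; isMonoid)
  open IsMonoid isMonoid using (identityˡ)

  ⇝-refl : Reflexive _⇝_
  ⇝-refl {x} = 0# , Φ-0 x

  ⇝-trans : Transitive _⇝_
  ⇝-trans {x} (t , refl) (u , refl) = _ , sym (Φ-+ x t u)

  ⇝-connected : LinearTime → ∀ {x y z} → x ⇝ y → x ⇝ z → y ⇝ z ⊎ z ⇝ y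
  ⇝-connected total {x} (t , refl) (u , refl) with total t u
  ... | inj₁ (c , refl) = inj₁ (c , Φ-+ x t c)
  ... | inj₂ (c , refl) = inj₂ (c , Φ-+ x u c)

  -- Every time satisfies `0# ≤ t`, so symmetry of the order provides `c` with `t + c ≡ 0#`, and
  -- flowing for `c` leads back.
  ⇝-sym : Invertible → Symmetric _⇝_
  ⇝-sym invertible {x} (t , refl) with invertible (t , identityˡ t)
  ... | c , t+c≡0 = c , trans (Φ-+ x t c) (trans (cong (Φ x) t+c≡0) (Φ-0 x))

  frame : Frame
  frame = record { W = S ; R = _⇝_ }

  realises : Realises frame 𝕊
  realises _ _ = mk⇔ id id

-- Soundness

module Soundness (em : ExcludedMiddle 0ℓ) {Atom : Set} {F : Frame} (M : Model Atom F) where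
  open Frame F
  open Model M

  ⊃-intro : ∀ {w A B} → (w ⊩ A → w ⊩ B) → w ⊩ A ⊃ B
  ⊃-intro {w} {A} {B} f with em {w ⊩ A}
  ... | yes a = from (⊩-⊃ w A B) (inj₂ (f a))
  ... | no ¬a = from (⊩-⊃ w A B) (inj₁ ¬a)

  ⊃-elim : ∀ {w A B} → w ⊩ A ⊃ B → w ⊩ A → w ⊩ B
  ⊃-elim {w} {A} {B} h a = [ contradiction a , id ]′ (to (⊩-⊃ w A B) h)

  ∼-intro : ∀ {w A} → ¬ w ⊩ A → w ⊩ ∼ A
  ∼-intro = from (⊩-∼ _ _)

  ∼-elim : ∀ {w A} → w ⊩ ∼ A → ¬ w ⊩ A
  ∼-elim = to (⊩-∼ _ _)

  □-intro : ∀ {w A} → (∀ {v} → R w v → v ⊩ A) → w ⊩ □ A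
  □-intro h = from (⊩-□ _ _) λ _ → h

  □-elim : ∀ {w v A} → w ⊩ □ A → R w v → v ⊩ A
  □-elim h = to (⊩-□ _ _) h _

  ⊩-by-contradiction : ∀ {w A} → ¬ ¬ w ⊩ A → w ⊩ A
  ⊩-by-contradiction {w} {A} h with em {w ⊩ A}
  ... | yes a = a
  ... | no ¬a = contradiction ¬a h

  sound : {Ax : Pred (Formula Atom) 0ℓ} → (∀ {A} → Ax A → ∀ w → w ⊩ A) →
          ∀ {A} → Ax ⊢ A → ∀ w → w ⊩ A
  sound ax-sound (ax a) w = ax-sound a w
  sound ax-sound (weak A B) w = ⊃-intro λ a → ⊃-intro λ _ → a
  sound ax-sound (distr A B C) w =
    ⊃-intro λ f → ⊃-intro λ g → ⊃-intro λ a → ⊃-elim (⊃-elim f a) (⊃-elim g a)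
  sound ax-sound (contra A B) w =
    ⊃-intro λ f → ⊃-intro λ b → ⊩-by-contradiction λ ¬a → ∼-elim (⊃-elim f (∼-intro ¬a)) b
  sound ax-sound (□-K A B) w =
    ⊃-intro λ f → ⊃-intro λ a → □-intro λ r → ⊃-elim (□-elim f r) (□-elim a r)
  sound ax-sound (mp d e) w = ⊃-elim (sound ax-sound d w) (sound ax-sound e w)
  sound ax-sound (nec d) w = □-intro λ _ → sound ax-sound d _

  S4-sound : Reflexive R → Transitive R → ∀ {A} → S4 A → ∀ w → w ⊩ A
  S4-sound rfl tra (□-T A) w = ⊃-intro λ a → □-elim a rfl
  S4-sound rfl tra (□-4 A) w = ⊃-intro λ a → □-intro λ r → □-intro λ s → □-elim a (tra r s)

  S4·3-sound : Reflexive R → Transitive R → (∀ {x y z} → R x y → R x z → R y z ⊎ R z y) →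
               ∀ {A} → S4·3 A → ∀ w → w ⊩ A
  S4·3-sound rfl tra conn (s4 a) w = S4-sound rfl tra a w
  S4·3-sound rfl tra conn (□-3 A B) w =
    ⊃-intro λ ¬AB → □-intro λ wv → ⊃-intro λ □b → ⊩-by-contradiction λ ¬a →
      ∼-elim ¬AB (□-intro λ wu → ⊃-intro λ □a →
        -- If v sees u, then `□b` gives B at u; if u sees v, then `□a` gives A at v, against `¬a`.
        [ □-elim □b , (λ uv → contradiction (□-elim □a uv) ¬a) ]′ (conn wv wu))

  S5-sound : Reflexive R → Transitive R → Symmetric R → ∀ {A} → S5 A → ∀ w → w ⊩ A
  S5-sound rfl tra symm (s4 a) w = S4-sound rfl tra a w
  S5-sound rfl tra symm (□-5 A) w =
    ⊃-intro λ ◇a → □-intro λ wv → ∼-intro λ □¬a →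
      ∼-elim ◇a (□-intro λ wu → □-elim □¬a (tra (symm wv) wu))

module _ (em : ExcludedMiddle 0ℓ) {Atom : Set} {F : Frame} (𝕊 : DynamicalSystem (Frame.W F))
         (real : Realises F 𝕊) (M : Model Atom F) where
  open Reachability 𝕊
  open Soundness em M
  open Frame F using (R)

  private
    R-refl : Reflexive R
    R-refl = to (real _ _) ⇝-refl

    R-trans : Transitive R
    R-trans r s = to (real _ _) (⇝-trans (from (real _ _) r) (from (real _ _) s))

  S4-orbital : ∀ {A} → S4 ⊢ A → ∀ w → Model._⊩_ M w A
  S4-orbital = sound (S4-sound R-refl R-trans)

  S4·3-linear : DynamicalSystem.LinearTime 𝕊 → ∀ {A} → S4·3 ⊢ A → ∀ w → Model._⊩_ M w A
  S4·3-linear lin = sound (S4·3-sound R-refl R-trans λ r s →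
    [ inj₁ ∘ to (real _ _) , inj₂ ∘ to (real _ _) ]′
      (⇝-connected lin (from (real _ _) r) (from (real _ _) s)))

  S5-invertible : DynamicalSystem.Invertible 𝕊 → ∀ {A} → S5 ⊢ A → ∀ w → Model._⊩_ M w A
  S5-invertible inv = sound (S5-sound R-refl R-trans λ r →
    to (real _ _) (⇝-sym inv (from (real _ _) r)))

-- Dynamical systems

module InflationarySystem {W : Set} (_≼_ : Rel W 0ℓ) where
  Inflationary : Set
  Inflationary = Σ[ g ∈ (W → W) ] ∀ w → w ≼ g w

  act : W → Inflationary → W
  act w (g , _) = g w

  -- Taking words in the maps, rather than composites, makes the monoid laws hold without comparing
  -- maps or the proofs that they are inflationary.
  system : DynamicalSystem W
  system = record
    { T = List Inflationary
    ; _+_ = _++_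
    ; 0# = []
    ; isMonoid = ++-isMonoid
    ; Φ = foldl act
    ; Φ-0 = λ _ → refl
    ; Φ-+ = λ s t u → sym (foldl-++ act s t u)
    }

  open DynamicalSystem system using (_⇝_)

  ⇝⇒≼ : Reflexive _≼_ → Transitive _≼_ → ∀ {x y} → x ⇝ y → x ≼ y
  ⇝⇒≼ rfl tra ([] , refl) = rfl
  ⇝⇒≼ rfl tra ((g , g-infl) ∷ gs , eq) = tra (g-infl _) (⇝⇒≼ rfl tra (gs , eq))

  -- A single letter suffices: the map that sends `x` to `y` and fixes every other state.
  ≼⇒⇝ : ExcludedMiddle 0ℓ → Reflexive _≼_ → ∀ {x y} → x ≼ y → x ⇝ y
  ≼⇒⇝ em rfl {x} {y} x≼y = (jump , jump-infl) ∷ [] , jump-x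
    where
    jump : W → W
    jump w with em {x ≡ w}
    ... | yes _ = y
    ... | no _  = w

    jump-infl : ∀ w → w ≼ jump w
    jump-infl w with em {x ≡ w}
    ... | yes refl = x≼y
    ... | no _     = rfl

    jump-x : jump x ≡ y
    jump-x with em {x ≡ x}
    ... | yes _  = refl
    ... | no x≢x = contradiction refl x≢x

regular : {T : Set} {_∙_ : T → T → T} {ε : T} → IsMonoid _≡_ _∙_ ε → DynamicalSystem T
regular {T} {_∙_} {ε} isMonoid = record
  { T = T
  ; _+_ = _∙_
  ; 0# = ε
  ; isMonoid = isMonoid
  ; Φ = _∙_
  ; Φ-0 = IsMonoid.identityʳ isMonoid
  ; Φ-+ = IsMonoid.assoc isMonoid
  }

ℤ-system : DynamicalSystem ℤ
ℤ-system = regular ℤ.+-0-isMonoid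

ℤ-total : ∀ x y → DynamicalSystem._⇝_ ℤ-system x y
ℤ-total x y = ℤ.- x ℤ.+ y , trans (sym (ℤ.+-assoc x (ℤ.- x) y))
  (trans (cong (ℤ._+ y) (ℤ.+-inverseʳ x)) (ℤ.+-identityˡ y))

-- (a , b) stands for the ordinal ω·a + b.
ω² : Set
ω² = ℕ × ℕ

-- Ordinal addition: a nonzero multiple of ω on the right absorbs the finite part `b` of the left
-- summand.
_⊕_ : ω² → ω² → ω²
(a , b) ⊕ (zero , d)  = a , b + d
(a , b) ⊕ (suc c , d) = a + suc c , d

⊕-assoc : ∀ x y z → (x ⊕ y) ⊕ z ≡ x ⊕ (y ⊕ z)
⊕-assoc (a , b) (zero , d)  (zero , f)  = cong (a ,_) (+-assoc b d f)
⊕-assoc (a , b) (zero , d)  (suc e , f) = refl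
⊕-assoc (a , b) (suc c , d) (zero , f)  = refl
⊕-assoc (a , b) (suc c , d) (suc e , f) = cong (_, f) (+-assoc a (suc c) (suc e))

⊕-identityˡ : ∀ x → (0 , 0) ⊕ x ≡ x
⊕-identityˡ (zero , b)  = refl
⊕-identityˡ (suc a , b) = refl

⊕-identityʳ : ∀ x → x ⊕ (0 , 0) ≡ x
⊕-identityʳ (a , b) = cong (a ,_) (+-identityʳ b)

ω²-system : DynamicalSystem ω²
ω²-system = regular record
  { isSemigroup = record
    { isMagma = record { isEquivalence = isEquivalence ; ∙-cong = cong₂ _⊕_ }
    ; assoc = ⊕-assoc
    }
  ; identity = ⊕-identityˡ , ⊕-identityʳ
  }

module ω² = DynamicalSystem ω²-system

-- The time ω·(o + 1) + d, where `suc a + o ≡ c`, absorbs `b`, so `b` and `d` may be arbitrary.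
ω²-later : ∀ {a c} b d → a < c → (a , b) ω².⇝ (c , d)
ω²-later {a} b d a<c with o , refl ← m≤n⇒∃[o]m+o≡n a<c = (suc o , d) , cong (_, d) (+-suc a o)

ω²-linear : ω².LinearTime
ω²-linear (a , b) (c , d) with <-cmp a c | ≤-total b d
... | tri< a<c _ _  | _        = inj₁ (ω²-later b d a<c)
... | tri> _ _ c<a  | _        = inj₂ (ω²-later d b c<a)
... | tri≈ _ refl _ | inj₁ b≤d with o , refl ← m≤n⇒∃[o]m+o≡n b≤d = inj₁ ((0 , o) , refl)
... | tri≈ _ refl _ | inj₂ d≤b with o , refl ← m≤n⇒∃[o]m+o≡n d≤b = inj₂ ((0 , o) , refl)

-- Lists

cycle : {A : Set} → A → List A → ℕ → A
cycle x xs n = lookup (x ∷ xs) (n mod suc (length xs))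

cycle-cofinal : ∀ {A : Set} {x y : A} {xs} → y ∈ x ∷ xs → ∀ b → ∃[ d ] cycle x xs (b + d) ≡ y
cycle-cofinal {x = x} {y} {xs} y∈ b =
  -- The list has `l + 1` entries, and `b + (i + b * l)` equals `i + b * (l + 1)`, which is
  -- congruent to the index `i`.
  toℕ i + b * l , trans (cong (lookup (x ∷ xs)) mod≡) (sym (lookup-index y∈))
  where
  l : ℕ
  l = length xs

  i : Fin (suc l)
  i = index y∈

  shift : ∀ b i l → b + (i + b * l) ≡ i + b * suc l
  shift = solve-∀

  mod≡ : (b + (toℕ i + b * l)) mod suc l ≡ i
  mod≡ = toℕ-injective (begin
    toℕ ((b + (toℕ i + b * l)) mod suc l) ≡⟨ toℕ-fromℕ< _ ⟩
    (b + (toℕ i + b * l)) % suc l         ≡⟨ cong (_% suc l) (shift b (toℕ i) l) ⟩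
    (toℕ i + b * suc l) % suc l           ≡⟨ [m+kn]%n≡m%n (toℕ i) b (suc l) ⟩
    toℕ i % suc l                         ≡⟨ m<n⇒m%n≡m (toℕ<n i) ⟩
    toℕ i                                 ∎)
    where open ≡-Reasoning

module _ {A : Set} {p q : A → Bool} where

  filterᵇ-length-mono : ∀ {xs} → (∀ {x} → x ∈ xs → T (p x) → T (q x)) →
                        length (filterᵇ p xs) ≤ length (filterᵇ q xs)
  filterᵇ-length-mono {[]} p⊆q = z≤n
  filterᵇ-length-mono {x ∷ xs} p⊆q
    with p x | q x | p⊆q {x} (here refl) | filterᵇ-length-mono {xs} (p⊆q ∘ there)
  ... | false | false | _ | le = le
  ... | false | true  | _ | le = m≤n⇒m≤1+n le
  ... | true  | true  | _ | le = s≤s le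
  ... | true  | false | f | _  = ⊥-elim (f _)

  -- An entry satisfying `q` but not `p` would make the `q`-filter strictly longer than the
  -- `p`-filter.
  filterᵇ-length-reflects : ∀ {xs} → (∀ {x} → x ∈ xs → T (p x) → T (q x)) →
                            length (filterᵇ q xs) ≤ length (filterᵇ p xs) →
                            ∀ {x} → x ∈ xs → T (q x) → T (p x)
  filterᵇ-length-reflects {y ∷ ys} p⊆q le x∈ qx
    with p y in py | q y in qy | p⊆q {y} (here refl)
       | filterᵇ-length-mono {ys} (p⊆q ∘ there) | filterᵇ-length-reflects {ys} (p⊆q ∘ there)
  filterᵇ-length-reflects {y ∷ ys} p⊆q le (here refl) qx | false | false | _ | _ | _ =
    ⊥-elim (subst T qy qx)
  filterᵇ-length-reflects {y ∷ ys} p⊆q le (there x∈) qx | false | false | _ | _ | ih = ih le x∈ qx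
  filterᵇ-length-reflects {y ∷ ys} p⊆q le x∈ qx | false | true | _ | mono | _ =
    contradiction (≤-trans le mono) 1+n≰n
  filterᵇ-length-reflects {y ∷ ys} p⊆q (s≤s le) (here refl) qx | true | true | _ | _ | _ =
    subst T (sym py) _
  filterᵇ-length-reflects {y ∷ ys} p⊆q (s≤s le) (there x∈) qx | true | true | _ | _ | ih =
    ih le x∈ qx
  filterᵇ-length-reflects {y ∷ ys} p⊆q le x∈ qx | true | false | f | _ | _ = ⊥-elim (f _)

-- Choice of elements and levels of a rank function

module Choice (em : ExcludedMiddle 0ℓ) {W : Set} where

  choose : Pred W 0ℓ → W → W
  choose P d with em {∃[ w ] P w}
  ... | yes (w , _) = w
  ... | no _        = d

  choose-satisfies : ∀ (P : Pred W 0ℓ) {d w} → P w → P (choose P d)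
  choose-satisfies P {w = w} Pw with em {∃[ w ] P w}
  ... | yes (_ , Pv) = Pv
  ... | no ∄         = contradiction (w , Pw) ∄

  choose-elim : ∀ {P d} (Q : Pred W 0ℓ) → P ⊆ Q → Q d → Q (choose P d)
  choose-elim {P} Q P⊆Q Qd with em {∃[ w ] P w}
  ... | yes (_ , Pv) = P⊆Q Pv
  ... | no _         = Qd

module Levels (em : ExcludedMiddle 0ℓ) {W : Set} (rank : W → ℕ) (root : W) where
  open Choice em {W}

  -- Ranks may have gaps: where no element has the next rank, the previous level is repeated.
  level : ℕ → W
  level zero    = root
  level (suc a) = choose (λ w → rank w ≡ rank root + suc a) (level a)

  level-≤ : ∀ a → rank (level a) ≤ rank root + a
  level-≤ zero    = ≤-reflexive (sym (+-identityʳ _))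
  level-≤ (suc a) = choose-elim (λ w → rank w ≤ rank root + suc a) ≤-reflexive
    (≤-trans (level-≤ a) (+-monoʳ-≤ (rank root) (n≤1+n a)))

  level-hit : ∀ a {w} → rank w ≡ rank root + a → rank (level a) ≡ rank root + a
  level-hit zero    _  = sym (+-identityʳ _)
  level-hit (suc a) eq = choose-satisfies (λ w → rank w ≡ rank root + suc a) eq

  -- A newly chosen level has a rank above the bound that `level-≤` puts on its predecessor; a
  -- repeated level changes nothing.
  level-mono : ∀ a o → rank (level a) ≤ rank (level (a + o))
  level-mono a zero    = ≤-reflexive (cong (rank ∘ level) (sym (+-identityʳ a)))
  level-mono a (suc o) rewrite +-suc a o = ≤-trans (level-mono a o)
    (choose-elim (λ w → rank (level (a + o)) ≤ rank w)
      (λ eq → ≤-trans (level-≤ (a + o))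
        (≤-trans (+-monoʳ-≤ (rank root) (n≤1+n _)) (≤-reflexive (sym eq))))
      ≤-refl)

-- Subformulas

module _ {Atom : Set} where

  -- Separating the head makes the list visibly nonempty, as `cycle` requires.
  subformulas properSubformulas : Formula Atom → List (Formula Atom)
  subformulas A = A ∷ properSubformulas A

  properSubformulas (atom _) = []
  properSubformulas (∼ A)    = subformulas A
  properSubformulas (A ⊃ B)  = subformulas A ++ subformulas B
  properSubformulas (□ A)    = subformulas A

-- Natural deduction

module Deduction {Atom : Set} (Ax : Pred (Formula Atom) 0ℓ) where
  infix 5 _▷_

  -- Necessitation is confined to theorems of `Ax` and never applied to hypotheses, which is what
  -- makes the deduction theorem hold.
  data _▷_ (P : Pred (Formula Atom) 0ℓ) : Pred (Formula Atom) 0ℓ where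
    hyp : ∀ {B} → P B → P ▷ B
    thm : ∀ {B} → Ax ⊢ B → P ▷ B
    _·_ : ∀ {B C} → P ▷ B ⊃ C → P ▷ B → P ▷ C

  infixl 9 _·_

  private variable
    P Q : Pred (Formula Atom) 0ℓ
    A B C : Formula Atom

  bind : (∀ {B} → P B → Q ▷ B) → P ▷ C → Q ▷ C
  bind f (hyp p) = f p
  bind f (thm t) = thm t
  bind f (d · e) = bind f d · bind f e

  ⊢-refl : Ax ⊢ A ⊃ A
  ⊢-refl {A} = mp (mp (distr A (A ⊃ A) A) (weak A (A ⊃ A))) (weak A A)

  deduction : P ∪ ｛ A ｝ ▷ B → P ▷ A ⊃ B
  deduction (hyp (inj₁ p))    = thm (weak _ _) · hyp p
  deduction (hyp (inj₂ refl)) = thm ⊢-refl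
  deduction (thm t)           = thm (weak _ _) · thm t
  deduction (d · e)           = thm (distr _ _ _) · deduction d · deduction e

  closed-thm : ∅ ▷ A → Ax ⊢ A
  closed-thm (thm t) = t
  closed-thm (d · e) = mp (closed-thm d) (closed-thm e)

  Inconsistent : Pred (Formula Atom) 0ℓ → Set
  Inconsistent P = ∀ {B} → P ▷ B

  explosion : P ▷ A → P ▷ ∼ A → Inconsistent P
  explosion d e {B} = thm (contra B _) · (thm (weak _ (∼ B)) · e) · d

  -- The inconsistent extension derives `∼ (A ⊃ A)` in particular, and `∼ A ⊃ ∼ (A ⊃ A)` contraposes
  -- to `(A ⊃ A) ⊃ A`.
  ∼-classical : Inconsistent (P ∪ ｛ ∼ A ｝) → P ▷ A
  ∼-classical {A = A} d = thm (contra A (A ⊃ A)) · deduction d · thm ⊢-refl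

  ∼∼-elim : P ▷ ∼ ∼ A → P ▷ A
  ∼∼-elim d = ∼-classical λ {_} → explosion (hyp (inj₂ refl)) (bind (hyp ∘ inj₁) d)

  ∼-intro : Inconsistent (P ∪ ｛ A ｝) → P ▷ ∼ A
  ∼-intro {A = A} d = ∼-classical λ {B} →
    bind (hyp ∘ inj₁) (deduction d) · ∼∼-elim (hyp (inj₂ refl))

  □-map : Ax ⊢ A ⊃ B → P ▷ □ A → P ▷ □ B
  □-map t d = thm (□-K _ _) · thm (nec t) · d

  ⊢-contrapose : Ax ⊢ A ⊃ B → Ax ⊢ ∼ B ⊃ ∼ A
  ⊢-contrapose t = closed-thm (deduction (∼-intro λ {_} →
    explosion (thm t · hyp (inj₂ refl)) (hyp (inj₁ (inj₂ refl)))))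

  ⊢-∼∼-elim : Ax ⊢ ∼ ∼ A ⊃ A
  ⊢-∼∼-elim = closed-thm (deduction (∼∼-elim (hyp (inj₂ refl))))

  ⊢-∼∼-intro : Ax ⊢ A ⊃ ∼ ∼ A
  ⊢-∼∼-intro = closed-thm (deduction (∼-intro λ {_} →
    explosion (hyp (inj₁ (inj₂ refl))) (hyp (inj₂ refl))))

  □-deduction : (∀ {B} → P B → Q ▷ □ B) → P ▷ C → Q ▷ □ C
  □-deduction f (hyp p) = f p
  □-deduction f (thm t) = thm (nec t)
  □-deduction f (d · e) = thm (□-K _ _) · □-deduction f d · □-deduction f e

-- Canonical models

module Canonical (em : ExcludedMiddle 0ℓ) {Atom : Set} (Ax : Pred (Formula Atom) 0ℓ)
                 (S4⊆Ax : S4 ⊆ Ax) (Θ : List (Formula Atom)) where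
  open Deduction Ax

  private variable
    A B C : Formula Atom
    L : List (Formula Atom)

  -- Theories are Boolean-valued so that worlds form a small type.
  record World : Set where
    field
      holds : Formula Atom → Bool

    theory : Pred (Formula Atom) 0ℓ
    theory B = T (holds B)

    field
      closed     : theory ▷ B → theory B
      consistent : ¬ Inconsistent theory
      decides    : B ∈ Θ → ¬ theory B → theory (∼ B)

    modus-ponens : theory (B ⊃ C) → theory B → theory C
    modus-ponens f b = closed (hyp f · hyp b)

    theorem : Ax ⊢ B → theory B
    theorem t = closed (thm t)

    noncontradiction : theory B → ¬ theory (∼ B)
    noncontradiction b ¬b = consistent (explosion (hyp b) (hyp ¬b))

    □-T-closed : theory (□ B) → theory B
    □-T-closed = modus-ponens (theorem (ax (S4⊆Ax (□-T _))))

    □-4-closed : theory (□ B) → theory (□ □ B)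
    □-4-closed = modus-ponens (theorem (ax (S4⊆Ax (□-4 _))))

  open World

  -- Each listed formula that is not yet derivable has its negation adjoined, which is consistent by
  -- `∼-classical`; a derivable one stays derivable in every extension.
  lindenbaum : ∀ {P} L → ¬ Inconsistent P →
               ∃[ Q ] (P ⊆ Q × ¬ Inconsistent Q × (∀ {B} → B ∈ L → ¬ Q ▷ B → Q ▷ ∼ B))
  lindenbaum {P} [] con = P , id , con , λ ()
  lindenbaum {P} (B ∷ L) con with em {P ▷ B}
  ... | yes d with Q , P⊆Q , conQ , dec ← lindenbaum L con =
    Q , P⊆Q , conQ , λ where
      (here refl) ¬d → contradiction (bind (λ p → hyp (P⊆Q p)) d) ¬d
      (there B∈)     → dec B∈
  ... | no ¬d with Q , P⊆Q , conQ , dec ← lindenbaum L (λ inc → ¬d (∼-classical λ {C} → inc {C})) =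
    Q , (λ p → P⊆Q (inj₁ p)) , conQ , λ where
      (here refl) _ → hyp (P⊆Q (inj₂ refl))
      (there B∈)    → dec B∈

  extend : ∀ {P A} → ¬ P ▷ A → ∃[ w ] (P ⊆ theory w × ¬ theory w A)
  extend {P} ¬d
    with Q , P⊆Q , con , dec ← lindenbaum Θ (λ inc → ¬d (∼-classical λ {C} → inc {C})) =
      w , (λ p → fromWitness (hyp (P⊆Q (inj₁ p)))) ,
      λ a → noncontradiction w a (fromWitness (hyp (P⊆Q (inj₂ refl))))
    where
    Q▷ : ∀ {B} → (λ C → T ⌊ em {Q ▷ C} ⌋) ▷ B → Q ▷ B
    Q▷ = bind toWitness

    w : World
    w = record
      { holds      = λ B → ⌊ em {Q ▷ B} ⌋
      ; closed     = λ d → fromWitness (Q▷ d)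
      ; consistent = λ inc → con (λ {B} → Q▷ (inc {B}))
      ; decides    = λ B∈ ¬d → fromWitness (dec B∈ (¬d ∘ fromWitness))
      }

  -- False off boxes, so that the order below compares only the boxed members of a list.
  holdsBox : World → Formula Atom → Bool
  holdsBox w (□ B) = holds w (□ B)
  holdsBox w _     = false

  infix 4 _≼[_]_

  record _≼[_]_ (w : World) (L : List (Formula Atom)) (v : World) : Set where
    constructor preserving
    field
      preserves : ∀ {B} → B ∈ L → T (holdsBox w B) → T (holdsBox v B)

  open _≼[_]_ public

  ≼-refl : ∀ {w} → w ≼[ L ] w
  ≼-refl = preserving λ _ → id

  ≼-trans : ∀ {w v u} → w ≼[ L ] v → v ≼[ L ] u → w ≼[ L ] u
  ≼-trans p q = preserving λ B∈ → preserves q B∈ ∘ preserves p B∈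

  ≼-++⁻ˡ : ∀ {w v} L {L′} → w ≼[ L ++ L′ ] v → w ≼[ L ] v
  ≼-++⁻ˡ _ p = preserving λ B∈ → preserves p (∈-++⁺ˡ B∈)

  -- The boxed formulas of `w` do not derive `B`: by axiom 4 each of them is boxed again in `w`, so
  -- `□-deduction` would yield `□ B`. A world extending them lies above `w`.
  refute-□ : ∀ w → ¬ theory w (□ B) → ∃[ v ] (w ≼[ Θ ] v × ¬ theory v B)
  refute-□ {B} w ¬□B =
    let v , P⊆v , ¬B = extend {P} λ d → ¬□B (closed w (□-deduction P⇒□ d))
    in  v , preserving (λ { {□ C} _ □C → P⊆v (C , refl , □C) }) , ¬B
    where
    P : Pred (Formula Atom) 0ℓ
    P D = ∃[ C ] (D ≡ □ C × theory w D)

    P⇒□ : ∀ {D} → P D → theory w ▷ □ D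
    P⇒□ (C , refl , □C) = hyp (□-4-closed w □C)

  module Truth (A : Formula Atom) (subs⊆Θ : ∀ {B} → B ∈ subformulas A → B ∈ Θ)
               {S : Set} (𝕊 : DynamicalSystem S) (f : S → World) where
    open DynamicalSystem 𝕊 using (_⇝_)
    open Reachability 𝕊 using (frame)

    module _ (forth : ∀ {s t} → s ⇝ t → f s ≼[ subformulas A ] f t)
             (back : ∀ {s B} → B ∈ subformulas A → ¬ theory (f s) (□ B) →
                     ∃[ t ] (s ⇝ t × ¬ theory (f t) B)) where

      infix 10 _⊩_

      _⊩_ : S → Formula Atom → Set
      s ⊩ atom p = theory (f s) (atom p)
      s ⊩ ∼ B    = ¬ s ⊩ B
      s ⊩ B ⊃ C  = ¬ s ⊩ B ⊎ s ⊩ C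
      s ⊩ □ B    = ∀ t → s ⇝ t → t ⊩ B

      model : Model Atom frame
      model = record
        { _⊩_ = _⊩_
        ; ⊩-∼ = λ _ _ → mk⇔ id id
        ; ⊩-⊃ = λ _ _ _ → mk⇔ id id
        ; ⊩-□ = λ _ _ → mk⇔ id id
        }

      -- By `forth` and `back`, `f` is a p-morphism as far as subformulas of `A` can tell, so the
      -- induction stays among these.
      truth : ∀ B → (∀ {C} → C ∈ subformulas B → C ∈ subformulas A) →
              ∀ s → s ⊩ B ⇔ theory (f s) B
      truth (atom p) _ s = mk⇔ id id
      truth (∼ B) sub s = mk⇔
        (λ ¬b → decides w (subs⊆Θ (sub (there (here refl)))) (¬b ∘ from ih))
        (λ ∼b b → noncontradiction w (to ih b) ∼b)
        where
        w = f s
        ih = truth B (sub ∘ there) s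
      truth (B ⊃ C) sub s = mk⇔
        (λ { (inj₁ ¬b) → closed w (deduction (explosion (hyp (inj₂ refl))
               (hyp (inj₁ (decides w B∈Θ (¬b ∘ from ihB))))))
           ; (inj₂ c) → modus-ponens w (theorem w (weak C B)) (to ihC c) })
        (λ b⊃c → [ (λ b → inj₂ (from ihC (modus-ponens w b⊃c b))) , (λ ¬b → inj₁ (¬b ∘ to ihB)) ]′
               theory-B?)
        where
        w = f s
        B∈Θ = subs⊆Θ (sub (there (here refl)))
        ihB = truth B (sub ∘ there ∘ ∈-++⁺ˡ) s
        ihC = truth C (sub ∘ there ∘ ∈-++⁺ʳ (subformulas B)) s

        theory-B? : theory w B ⊎ ¬ theory w B
        theory-B? with em {theory w B}
        ... | yes b = inj₁ b
        ... | no ¬b = inj₂ ¬b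
      truth (□ B) sub s = mk⇔ ⇒ ⇐
        where
        ih = truth B (sub ∘ there)

        ⇒ : s ⊩ □ B → theory (f s) (□ B)
        ⇒ □b with em {theory (f s) (□ B)}
        ... | yes □B = □B
        ... | no ¬□B =
          let t , s⇝t , ¬B = back (sub (there (here refl))) ¬□B
          in  contradiction (to (ih t) (□b t s⇝t)) ¬B

        ⇐ : theory (f s) (□ B) → s ⊩ □ B
        -- `forth` carries the box itself to `t`, where axiom T removes it.
        ⇐ □B t s⇝t = from (ih t) (□-T-closed (f t) (preserves (forth s⇝t) (sub (here refl)) □B))

      not-refuted : frame ⊨ A → ∀ s → theory (f s) A
      not-refuted valid s = to (truth A id s) (valid model s)

  provable : (∀ w → ¬ ¬ theory w A) → Ax ⊢ A
  provable {A} h with em {Ax ⊢ A}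
  ... | yes t = t
  ... | no ¬t =
    let w , _ , ¬A = extend {∅} (¬t ∘ closed-thm)
    in  contradiction ¬A (h w)

-- Completeness

module _ (em : ExcludedMiddle 0ℓ) {Atom : Set} (A : Formula Atom) where

  private
    subs : List (Formula Atom)
    subs = subformulas A

    -- A schedule of formulas to refute, in which every subformula recurs arbitrarily late.
    challenge : ℕ → Formula Atom
    challenge = cycle A (properSubformulas A)

  S4-complete : (∀ F → Orbital F → F ⊨ A) → S4 ⊢ A
  S4-complete valid = provable λ w ¬A → ¬A (not-refuted
    (⇝⇒≼ ≼-refl ≼-trans)
    (λ {w} _ ¬□B → let v , w≼v , ¬B = refute-□ w ¬□B in v , ≼⇒⇝ em ≼-refl w≼v , ¬B)
    (valid frame (system , realises)) w)
    where
    open Canonical em S4 id subs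
    open InflationarySystem _≼[ subs ]_
    open Reachability system
    open Truth A id system id

  -- Completeness of S5: integer time on a cluster

  module _ (valid : ∀ F → InvertibleOrbital F → F ⊨ A) where
    open Canonical em S5 s4 (subs ++ map (λ B → □ ∼ B) subs)
    open World
    open Deduction (S5 {Atom})
    open Reachability ℤ-system using (frame; realises)

    -- This is axiom 5 for `∼ B`, whose diamond unfolds to `∼ □ ∼ ∼ B`; the double negations are
    -- cleared under the boxes.
    ∼□-stable : ∀ w {B} → theory w (∼ □ B) → theory w (□ ∼ □ B)
    ∼□-stable w ∼□B = closed w (□-map (⊢-contrapose (closed-thm (deduction
        (□-map ⊢-∼∼-intro (hyp (inj₂ refl))))))
      (thm (ax (□-5 _)) · (thm (⊢-contrapose (closed-thm (deduction
        (□-map ⊢-∼∼-elim (hyp (inj₂ refl)))))) · hyp ∼□B)))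

    -- If `v` contains `□ B` and `w` does not, then `w` contains `∼ □ B`, hence `□ ∼ □ B`. That
    -- formula is in the added part of the list, so it passes to `v`, where axiom T contradicts
    -- `□ B`.
    ≼-symmetric : ∀ {w v} → w ≼[ subs ++ map (λ B → □ ∼ B) subs ] v → v ≼[ subs ] w
    ≼-symmetric {w} {v} w≼v = preserving λ {B} → v≼w B
      where
      v≼w : ∀ B → B ∈ subs → T (holdsBox v B) → T (holdsBox w B)
      v≼w (□ B) B∈ □B with em {theory w (□ B)}
      ... | yes p = p
      ... | no ¬p = contradiction
        (□-T-closed v (preserves w≼v {□ ∼ □ B} (∈-++⁺ʳ subs (∈-map⁺ _ B∈))
          (∼□-stable w (decides w (∈-++⁺ˡ B∈) ¬p))))
        (noncontradiction v □B)

    module _ (w₀ : World) where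
      open Choice em

      InCluster : Pred World 0ℓ
      InCluster w = w₀ ≼[ subs ] w × w ≼[ subs ] w₀

      RefutesInCluster : Formula Atom → Pred World 0ℓ
      RefutesInCluster B w = InCluster w × ¬ theory w B

      -- The default `w₀` keeps the state in the cluster even when no world there refutes the
      -- challenge.
      f : ℤ → World
      f z = choose (RefutesInCluster (challenge ∣ z ∣)) w₀

      f-cluster : ∀ z → InCluster (f z)
      f-cluster z = choose-elim InCluster proj₁ (≼-refl , ≼-refl)

      f-refutes : ∀ {w B} → B ∈ subs → InCluster w → ¬ theory w B → ∃[ z ] ¬ theory (f z) B
      f-refutes {w} {B} B∈ w∼ ¬B with d , refl ← cycle-cofinal B∈ 0 =
        ℤ.+ d , proj₂ (choose-satisfies (RefutesInCluster (challenge d)) (w∼ , ¬B))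

      open Truth A ∈-++⁺ˡ ℤ-system f

      S5-world : ¬ ¬ theory w₀ A
      S5-world ¬A =
        let z , ¬fz = f-refutes (here refl) (≼-refl , ≼-refl) ¬A
        in  ¬fz (not-refuted
          (λ {s} {t} _ → ≼-trans (proj₂ (f-cluster s)) (proj₁ (f-cluster t)))
          (λ {s} B∈ ¬□B →
            let v , w≼v , ¬B = refute-□ (f s) ¬□B
                p , q = f-cluster s
                t , ¬ft = f-refutes B∈
                  (≼-trans p (≼-++⁻ˡ subs w≼v) , ≼-trans (≼-symmetric w≼v) q) ¬B
            in  t , ℤ-total s t , ¬ft)
          (valid frame (ℤ-system , (λ {x} {y} _ → ℤ-total y x) , realises)) z)

    S5-complete : S5 ⊢ A
    S5-complete = provable S5-world

  -- Completeness of S4.3: ordinal time climbing through ranks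

  module _ (valid : ∀ F → LinearTimeOrbital F → F ⊨ A) where
    private
      pairs : List (Formula Atom)
      pairs = cartesianProductWith (λ P Q → □ (□ P ⊃ Q)) subs subs

      Θ : List (Formula Atom)
      Θ = subs ++ pairs

    open Canonical em S4·3 s4 Θ
    open World
    open Reachability ω²-system using (frame; realises)

    module _ (w₀ : World) where

      Above : Set
      Above = ∃[ w ] w₀ ≼[ Θ ] w

      boxed : Above → Formula Atom → Bool
      boxed (w , _) = holdsBox w

      rank : Above → ℕ
      rank x = length (filterᵇ (boxed x) subs)

      root : Above
      root = w₀ , ≼-refl

      _≼_ : Rel Above 0ℓ
      (w , _) ≼ (v , _) = w ≼[ subs ] v

      -- The boxed implication belongs to `Θ`, so it passes from `w₀` to every world above; its
      -- antecedent `□ □ P` comes from `□ P` by axiom 4.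
      transfer : ∀ ((w , _) : Above) {P Q} → □ P ∈ subs → □ Q ∈ subs →
                 theory w₀ (□ (□ □ P ⊃ □ Q)) → theory w (□ P) → theory w (□ Q)
      transfer (w , w₀≼w) {P} {Q} P∈ Q∈ h □P = modus-ponens w
        (□-T-closed w (preserves w₀≼w {□ (□ □ P ⊃ □ Q)}
          (∈-++⁺ʳ subs (∈-cartesianProductWith⁺ (λ P Q → □ (□ P ⊃ Q)) P∈ Q∈)) h))
        (□-4-closed w □P)

      -- The first alternative is in `Θ`, so `w₀` contains it or its negation; the negation triggers
      -- the disjunction of axiom 3.
      comparable : ∀ {P Q} → □ P ∈ subs → □ Q ∈ subs →
                   theory w₀ (□ (□ □ P ⊃ □ Q)) ⊎ theory w₀ (□ (□ □ Q ⊃ □ P))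
      comparable {P} {Q} P∈ Q∈ with em {theory w₀ (□ (□ □ P ⊃ □ Q))}
      ... | yes p = inj₁ p
      ... | no ¬p = inj₂ (modus-ponens w₀ (theorem w₀ (ax (□-3 (□ P) (□ Q))))
        (decides w₀ (∈-++⁺ʳ subs (∈-cartesianProductWith⁺ (λ P Q → □ (□ P ⊃ Q)) P∈ Q∈)) ¬p))

      -- Suppose `□ Q` holds at `y` but not at `x`. For any `□ P` at `x`, `□ P` cannot force `□ Q`,
      -- so by `comparable` `□ Q` forces `□ P`, which thus holds at `y`.
      ≼-total : ∀ x y → x ≼ y ⊎ y ≼ x
      ≼-total x y with em {x ≼ y}
      ... | yes x≼y = inj₁ x≼y
      ... | no x⋠y = inj₂ (preserving λ {B} → y≼x B)
        where
        y≼x : ∀ B → B ∈ subs → T (boxed y B) → T (boxed x B)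
        y≼x (□ Q) Q∈ yQ with em {theory (proj₁ x) (□ Q)}
        ... | yes xQ = xQ
        ... | no ¬xQ = contradiction (preserving λ {B} → x≼y B) x⋠y
          where
          x≼y : ∀ B → B ∈ subs → T (boxed x B) → T (boxed y B)
          x≼y (□ P) P∈ xP = [ (λ h → contradiction (transfer x P∈ Q∈ h xP) ¬xQ)
                            , (λ h → transfer y Q∈ P∈ h yQ) ]′ (comparable P∈ Q∈)

      ≼⇒rank : ∀ {x y} → x ≼ y → rank x ≤ rank y
      ≼⇒rank x≼y = filterᵇ-length-mono (preserves x≼y)

      -- If instead `y ≼ x`, the boxes counted at `y` are among those counted at `x`, and `le`
      -- forces the two sets to coincide.
      rank⇒≼ : ∀ {x y} → rank x ≤ rank y → x ≼ y
      rank⇒≼ {x} {y} le with ≼-total x y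
      ... | inj₁ x≼y = x≼y
      ... | inj₂ y≼x = preserving (filterᵇ-length-reflects (preserves y≼x) le)

      open Choice em {Above}
      open Levels em rank root

      RefutesAtLevel : ℕ → Formula Atom → Pred Above 0ℓ
      RefutesAtLevel a B x = rank x ≡ rank (level a) × ¬ theory (proj₁ x) B

      -- The coefficient `a` fixes the rank and `b` the formula to refute; the default `level a`
      -- already has that rank.
      g : ω² → Above
      g (a , b) = choose (RefutesAtLevel a (challenge b)) (level a)

      g-rank : ∀ s → rank (g s) ≡ rank (level (proj₁ s))
      g-rank (a , b) = choose-elim (λ x → rank x ≡ rank (level a)) proj₁ refl

      g-mono : ∀ {s t} → s ω².⇝ t → rank (g s) ≤ rank (g t)
      g-mono {s} {t} s⇝t = ≤-trans (≤-reflexive (g-rank s))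
        (≤-trans (levels s⇝t) (≤-reflexive (sym (g-rank t))))
        where
        levels : ∀ {s t} → s ω².⇝ t → rank (level (proj₁ s)) ≤ rank (level (proj₁ t))
        levels ((zero , _) , refl)            = ≤-refl
        levels {a , _} ((suc c , _) , refl) = level-mono a (suc c)

      g-refutes : ∀ {x B} a b → B ∈ subs → rank x ≡ rank (level a) → ¬ theory (proj₁ x) B →
                  ∃[ d ] ¬ theory (proj₁ (g (a , b + d))) B
      g-refutes {x} a b B∈ eq ¬B with d , refl ← cycle-cofinal B∈ b =
        d , proj₂ (choose-satisfies (RefutesAtLevel a (challenge (b + d))) {w = x} (eq , ¬B))

      -- The excess `c` of `rank y` over the root names a level of the same rank as `y`. A level
      -- beyond `a` is entered directly; otherwise monotonicity makes `y` equal in rank to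
      -- `level a`, and the challenge `B` recurs after `b`.
      g-climbs : ∀ {a B} b y → B ∈ subs → rank (level a) ≤ rank y → ¬ theory (proj₁ y) B →
                 ∃[ t ] ((a , b) ω².⇝ t × ¬ theory (proj₁ (g t)) B)
      g-climbs {a} {B} b y B∈ a≤y ¬B = go (≤-<-connex c a)
        where
        c : ℕ
        c = rank y ∸ rank root

        y-rank : rank y ≡ rank root + c
        y-rank = sym (m+[n∸m]≡n (≼⇒rank {root} {y} (≼-++⁻ˡ subs (proj₂ y))))

        level-c : rank y ≡ rank (level c)
        level-c = trans y-rank (sym (level-hit c {y} y-rank))

        go : c ≤ a ⊎ a < c → ∃[ t ] ((a , b) ω².⇝ t × ¬ theory (proj₁ (g t)) B)
        go (inj₁ c≤a) =
          let o , c+o≡a = m≤n⇒∃[o]m+o≡n c≤a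
              y≤a = subst (λ n → rank y ≤ rank (level n)) c+o≡a
                      (≤-trans (≤-reflexive level-c) (level-mono c o))
              d , ¬gB = g-refutes {y} a b B∈ (≤-antisym y≤a a≤y) ¬B
          in  (a , b + d) , ((0 , d) , refl) , ¬gB
        go (inj₂ a<c) =
          let d , ¬gB = g-refutes {y} c 0 B∈ level-c ¬B
          in  (c , d) , ω²-later b d a<c , ¬gB

      g-back : ∀ {s B} → B ∈ subs → ¬ theory (proj₁ (g s)) (□ B) →
               ∃[ t ] (s ω².⇝ t × ¬ theory (proj₁ (g t)) B)
      g-back {a , b} B∈ ¬□B =
        let x = g (a , b)
            v , x≼v , ¬B = refute-□ (proj₁ x) ¬□B
            y = v , ≼-trans (proj₂ x) x≼v
        in  g-climbs b y B∈
              (≤-trans (≤-reflexive (sym (g-rank (a , b))))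
                (≼⇒rank {x} {y} (≼-++⁻ˡ subs x≼v)))
              ¬B

      open Truth A ∈-++⁺ˡ ω²-system (proj₁ ∘ g)

      S4·3-world : ¬ ¬ theory w₀ A
      S4·3-world ¬A =
        let d , ¬gA = g-refutes {root} 0 0 (here refl) refl ¬A
        in  ¬gA (not-refuted
          (λ {s} {t} s⇝t → rank⇒≼ {g s} {g t} (g-mono s⇝t))
          g-back
          (valid frame (ω²-system , ω²-linear , realises)) (0 , d))

    S4·3-complete : S4·3 ⊢ A
    S4·3-complete = provable S4·3-world

theorem46 : ExcludedMiddle 0ℓ → (Atom : Set) → (A : Formula Atom) →
    ((S4 ⊢ A) ⇔ ((F : Frame) → Orbital F → F ⊨ A))
    × ((S4·3 ⊢ A) ⇔ ((F : Frame) → LinearTimeOrbital F → F ⊨ A))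
    × ((S5 ⊢ A) ⇔ ((F : Frame) → InvertibleOrbital F → F ⊨ A))
theorem46 em Atom A =
    mk⇔ (λ d F (𝕊 , real) M → S4-orbital em 𝕊 real M d) (S4-complete em A)
  , mk⇔ (λ d F (𝕊 , lin , real) M → S4·3-linear em 𝕊 real M lin d) (S4·3-complete em A)
  , mk⇔ (λ d F (𝕊 , inv , real) M → S5-invertible em 𝕊 real M inv d) (S5-complete em A)
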